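{- Let $\mathbf{g}\in H_{1,2,2}$ with $N(\mathbf{g})$ even. Then there exist $\mathbf{h},\mathbf{h}'\in H_{1,2,2}$ with $\mathbf{g} = (1+\mathbf{i})\mathbf{h}$ and $\mathbf{g} = \mathbf{h}'(1+\mathbf{i})$; i.e. $1+\mathbf{i}$ is both a left factor and a right factor of $\mathbf{g}$ in $H_{1,2,2}$.
   Context: Let $\mathbf{i},\mathbf{j},\mathbf{k}$ be the standard basis units of the real quaternions. For a quaternion $\mathbf{q}=q_1+q_2\mathbf{i}+q_3\mathbf{j}+q_4\mathbf{k}$, its conjugate is $\overline{\mathbf{q}}=q_1-q_2\mathbf{i}-q_3\mathbf{j}-q_4\mathbf{k}$ and its norm is $N(\mathbf{q})=\mathbf{q}\overline{\mathbf{q}}$. $H_{1,2,2}$ is the $\mathbb{Z}$-module generated by $\mathbf{v}_1=1$, $\mathbf{v}_2=\mathbf{i}$, $\mathbf{v}_3=\tfrac12(1+\mathbf{i}+\sqrt2\,\mathbf{j})$, $\mathbf{v}_4=\tfrac12(1+\mathbf{i}+\sqrt2\,\mathbf{k})$; it is a subring of the quaternions, closed under conjugation, with the norm taking nonnegative integer values on it. -}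

module Defs where

open import Algebra.Bundles using (CommutativeRing)
open import Algebra.Structures using (IsCommutativeRing)
open import Data.Integer.Base as ℤ using (ℤ; +_; +[1+_])
import Data.Integer.Divisibility as ℤ
import Data.Integer.Properties as ℤ
open import Data.Nat.Base as ℕ using (ℕ; zero; suc)
import Data.Nat.Properties as ℕ
open import Data.Nat.Solver as ℕ-Solver using ()
open import Data.Integer.Solver as ℤ-Solver using ()
open import Data.Product.Base using (∃; ∃-syntax; _×_; _,_; proj₁; proj₂)
open import Data.Rational.Base as ℚ using (ℚ; 0ℚ; 1ℚ; ½; mkℚ)
import Data.Rational.Properties as ℚ
open import Data.Rational.Solver as ℚ-Solver using ()
open import Data.Rational.Unnormalised.Base as ℚᵘ using (mkℚᵘ; *≡*; *≤*; *<*)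
import Data.Rational.Unnormalised.Properties as ℚᵘ
open import Data.Sum.Base using (inj₁; inj₂)
open import Level using (0ℓ)
open import Relation.Binary.PropositionalEquality
  using (_≡_; refl; sym; trans; cong; subst)
open import Relation.Binary.Structures using (IsEquivalence)
open import Relation.Nullary.Decidable using (yes; no)

private
  ∣_∣ : ℚ → ℚ
  ∣_∣ = ℚ.∣_∣

  half-pos : ∀ {ε} → 0ℚ ℚ.< ε → 0ℚ ℚ.< ½ ℚ.* ε
  half-pos {ε} 0<ε =
    ℚ.positive⁻¹ (½ ℚ.* ε) {{ℚ.pos*pos⇒pos ½ ε {{ℚ.positive 0<ε}}}}

  half+half : ∀ ε → ½ ℚ.* ε ℚ.+ ½ ℚ.* ε ≡ ε
  half+half = solve 1 (λ ε → con ½ :* ε :+ con ½ :* ε := ε) refl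
    where open ℚ-Solver.+-*-Solver

  0<1+∣_∣ : ∀ p → 0ℚ ℚ.< 1ℚ ℚ.+ ∣ p ∣
  0<1+∣ p ∣ = ℚ.+-mono-<-≤ (ℚ.positive⁻¹ 1ℚ) (ℚ.0≤∣p∣ p)

  dist-refl : ∀ {p q ε} → p ≡ q → 0ℚ ℚ.< ε → ∣ p ℚ.- q ∣ ℚ.< ε
  dist-refl {p} {ε = ε} refl 0<ε =
    subst (ℚ._< ε) (sym (cong ∣_∣ (ℚ.+-inverseʳ p))) 0<ε

  dist-comm : ∀ p q → ∣ p ℚ.- q ∣ ≡ ∣ q ℚ.- p ∣
  dist-comm p q = trans
    (cong ∣_∣ (solve 2 (λ p q → p :- q := :- (q :- p)) refl p q))
    (ℚ.∣-p∣≡∣p∣ (q ℚ.- p))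
    where open ℚ-Solver.+-*-Solver

  sum-bound : ∀ {p q ε} →
              ∣ p ∣ ℚ.< ½ ℚ.* ε → ∣ q ∣ ℚ.< ½ ℚ.* ε → ∣ p ℚ.+ q ∣ ℚ.< ε
  sum-bound {p} {q} {ε} p< q< = ℚ.≤-<-trans (ℚ.∣p+q∣≤∣p∣+∣q∣ p q)
    (subst (∣ p ∣ ℚ.+ ∣ q ∣ ℚ.<_) (half+half ε) (ℚ.+-mono-< p< q<))

  dist-trans : ∀ p q r {ε} → ∣ p ℚ.- q ∣ ℚ.< ½ ℚ.* ε → ∣ q ℚ.- r ∣ ℚ.< ½ ℚ.* ε →
               ∣ p ℚ.- r ∣ ℚ.< ε
  dist-trans p q r {ε} pq qr = subst (λ z → ∣ z ∣ ℚ.< ε)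
    (solve 3 (λ p q r → (p :- q) :+ (q :- r) := p :- r) refl p q r)
    (sum-bound pq qr)
    where open ℚ-Solver.+-*-Solver

  dist-+ : ∀ a b c d {ε} → ∣ a ℚ.- c ∣ ℚ.< ½ ℚ.* ε → ∣ b ℚ.- d ∣ ℚ.< ½ ℚ.* ε →
           ∣ (a ℚ.+ b) ℚ.- (c ℚ.+ d) ∣ ℚ.< ε
  dist-+ a b c d {ε} ac bd = subst (λ z → ∣ z ∣ ℚ.< ε)
    (solve 4 (λ a b c d → (a :- c) :+ (b :- d) := (a :+ b) :- (c :+ d)) refl a b c d)
    (sum-bound ac bd)
    where open ℚ-Solver.+-*-Solver

  dist-neg : ∀ p q {ε} → ∣ p ℚ.- q ∣ ℚ.< ε → ∣ (ℚ.- p) ℚ.- (ℚ.- q) ∣ ℚ.< ε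
  dist-neg p q {ε} pq = subst (ℚ._< ε)
    (trans (dist-comm p q)
           (cong ∣_∣ (solve 2 (λ p q → q :- p := (:- p) :- (:- q)) refl p q)))
    pq
    where open ℚ-Solver.+-*-Solver

  product-bound : ∀ {p q A δ} → 0ℚ ℚ.< A → ∣ p ∣ ℚ.< A → ∣ q ∣ ℚ.< δ →
                  ∣ p ℚ.* q ∣ ℚ.< A ℚ.* δ
  product-bound {p} {q} {A} {δ} 0<A p<A q<δ = begin-strict
    ∣ p ℚ.* q ∣      ≡⟨ ℚ.∣p*q∣≡∣p∣*∣q∣ p q ⟩
    ∣ p ∣ ℚ.* ∣ q ∣  ≤⟨ ℚ.*-monoʳ-≤-nonNeg ∣ q ∣ {{ℚ.∣-∣-nonNeg q}} (ℚ.<⇒≤ p<A) ⟩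
    A ℚ.* ∣ q ∣      <⟨ ℚ.*-monoʳ-<-pos A {{ℚ.positive 0<A}} q<δ ⟩
    A ℚ.* δ          ∎
    where open ℚ.≤-Reasoning

  dist-* : ∀ a b c d {A D δ₁ δ₂ ε} → 0ℚ ℚ.< A → 0ℚ ℚ.< D →
           ∣ a ∣ ℚ.< A → ∣ d ∣ ℚ.< D → A ℚ.* δ₁ ≡ ½ ℚ.* ε → D ℚ.* δ₂ ≡ ½ ℚ.* ε →
           ∣ a ℚ.- c ∣ ℚ.< δ₂ → ∣ b ℚ.- d ∣ ℚ.< δ₁ →
           ∣ a ℚ.* b ℚ.- c ℚ.* d ∣ ℚ.< ε
  dist-* a b c d {ε = ε} 0<A 0<D a<A d<D eq₁ eq₂ ac bd = subst (λ z → ∣ z ∣ ℚ.< ε)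
    (solve 4 (λ a b c d → a :* (b :- d) :+ d :* (a :- c) := a :* b :- c :* d)
       refl a b c d)
    (sum-bound
      (subst (∣ a ℚ.* (b ℚ.- d) ∣ ℚ.<_) eq₁ (product-bound 0<A a<A bd))
      (subst (∣ d ℚ.* (a ℚ.- c) ∣ ℚ.<_) eq₂ (product-bound 0<D d<D ac)))
    where open ℚ-Solver.+-*-Solver

  quotient : ∀ {A ε} → 0ℚ ℚ.< A → 0ℚ ℚ.< ε → ∃[ δ ] 0ℚ ℚ.< δ × A ℚ.* δ ≡ ε
  quotient {A} {ε} 0<A 0<ε =
      1/A ℚ.* ε
    , ℚ.positive⁻¹ (1/A ℚ.* ε)
        {{ℚ.pos*pos⇒pos 1/A {{ℚ.1/pos⇒pos A}} ε {{ℚ.positive 0<ε}}}}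
    , trans (sym (ℚ.*-assoc A 1/A ε))
        (trans (cong (ℚ._* ε) (ℚ.*-inverseʳ A)) (ℚ.*-identityˡ ε))
    where
    instance
      A⁺ : ℚ.Positive A
      A⁺ = ℚ.positive 0<A
      A≢0 : ℚ.NonZero A
      A≢0 = ℚ.pos⇒nonZero A
    1/A : ℚ
    1/A = ℚ.1/ A

  ⊔-split : ∀ {m n k} → m ℕ.⊔ n ℕ.≤ k → m ℕ.≤ k × n ℕ.≤ k
  ⊔-split {m} {n} le = ℕ.m⊔n≤o⇒m≤o m n le , ℕ.m⊔n≤o⇒n≤o m n le

-- The real numbers: Cauchy sequences of rationals, with the sequences
-- whose difference tends to 0 identified by _≈_

IsCauchy : (ℕ → ℚ) → Set
IsCauchy s = ∀ ε → 0ℚ ℚ.< ε →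
  ∃[ N ] ∀ m n → N ℕ.≤ m → N ℕ.≤ n → ∣ s m ℚ.- s n ∣ ℚ.< ε

record ℝ : Set where
  constructor mkℝ
  field
    seq    : ℕ → ℚ
    cauchy : IsCauchy seq

open ℝ public

infix 4 _≈_

record _≈_ (x y : ℝ) : Set where
  constructor mk≈
  field
    close : ∀ ε → 0ℚ ℚ.< ε →
            ∃[ N ] ∀ n → N ℕ.≤ n → ∣ seq x n ℚ.- seq y n ∣ ℚ.< ε

open _≈_ public

fromℚ : ℚ → ℝ
fromℚ p = mkℝ (λ _ → p) (λ ε 0<ε → 0 , λ _ _ _ _ → dist-refl {p} refl 0<ε)

fromℤ : ℤ → ℝ
fromℤ z = fromℚ (z ℚ./ 1)

infixl 6 _+_
infixl 7 _*_
infix  8 -_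

_+_ : ℝ → ℝ → ℝ
x + y = mkℝ (λ n → seq x n ℚ.+ seq y n) λ ε 0<ε →
  let N₁ , p = cauchy x (½ ℚ.* ε) (half-pos 0<ε)
      N₂ , q = cauchy y (½ ℚ.* ε) (half-pos 0<ε)
  in N₁ ℕ.⊔ N₂ , λ m n m≥ n≥ →
    let m₁ , m₂ = ⊔-split m≥
        n₁ , n₂ = ⊔-split n≥
    in dist-+ (seq x m) (seq y m) (seq x n) (seq y n) (p m n m₁ n₁) (q m n m₂ n₂)

-_ : ℝ → ℝ
- x = mkℝ (λ n → ℚ.- seq x n) λ ε 0<ε →
  let N , p = cauchy x ε 0<ε
  in N , λ m n m≥ n≥ → dist-neg (seq x m) (seq x n) (p m n m≥ n≥)

private
  bounded : ∀ x → ∃[ A ] 0ℚ ℚ.< A × ∃[ N ] ∀ n → N ℕ.≤ n → ∣ seq x n ∣ ℚ.< A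
  bounded x =
    let N , p = cauchy x 1ℚ (ℚ.positive⁻¹ 1ℚ)
        b     = seq x N
    in 1ℚ ℚ.+ ∣ b ∣ , 0<1+∣ b ∣ , N , λ n n≥ → begin-strict
      ∣ seq x n ∣                    ≡⟨ cong ∣_∣ (lemma (seq x n) b) ⟩
      ∣ (seq x n ℚ.- b) ℚ.+ b ∣      ≤⟨ ℚ.∣p+q∣≤∣p∣+∣q∣ (seq x n ℚ.- b) b ⟩
      ∣ seq x n ℚ.- b ∣ ℚ.+ ∣ b ∣    <⟨ ℚ.+-monoˡ-< ∣ b ∣ (p n N n≥ ℕ.≤-refl) ⟩
      1ℚ ℚ.+ ∣ b ∣                   ∎
    where
    open ℚ.≤-Reasoning
    open ℚ-Solver.+-*-Solver
    lemma : ∀ a b → a ≡ (a ℚ.- b) ℚ.+ b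
    lemma = solve 2 (λ a b → a := (a :- b) :+ b) refl

_*_ : ℝ → ℝ → ℝ
x * y = mkℝ (λ n → seq x n ℚ.* seq y n) λ ε 0<ε →
  let A , 0<A , M₁ , x<A = bounded x
      D , 0<D , M₂ , y<D = bounded y
      δ₁ , 0<δ₁ , eq₁    = quotient 0<A (half-pos 0<ε)
      δ₂ , 0<δ₂ , eq₂    = quotient 0<D (half-pos 0<ε)
      N₁ , p             = cauchy x δ₂ 0<δ₂
      N₂ , q             = cauchy y δ₁ 0<δ₁
  in (M₁ ℕ.⊔ M₂) ℕ.⊔ (N₁ ℕ.⊔ N₂) , λ m n m≥ n≥ →
    let mM , mN = ⊔-split {M₁ ℕ.⊔ M₂} m≥
        nM , nN = ⊔-split {M₁ ℕ.⊔ M₂} n≥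
        m₁ , m₂ = ⊔-split mN
        n₁ , n₂ = ⊔-split nN
    in dist-* (seq x m) (seq y m) (seq x n) (seq y n) 0<A 0<D
         (x<A m (proj₁ (⊔-split {M₁} mM))) (y<D n (proj₂ (⊔-split {M₁} nM))) eq₁ eq₂
         (p m n m₁ n₁) (q m n m₂ n₂)

private
  pointwise : ∀ {x y} → (∀ n → seq x n ≡ seq y n) → x ≈ y
  pointwise eq = mk≈ λ ε 0<ε → 0 , λ n _ → dist-refl (eq n) 0<ε

  ≈-isEquivalence : IsEquivalence _≈_
  ≈-isEquivalence = record
    { refl  = pointwise λ _ → refl
    ; sym   = λ {x} {y} x≈y → mk≈ λ ε 0<ε →
        let N , p = close x≈y ε 0<ε
        in N , λ n n≥ → subst (ℚ._< ε) (dist-comm (seq x n) (seq y n)) (p n n≥)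
    ; trans = λ {x} {y} {z} x≈y y≈z → mk≈ λ ε 0<ε →
        let N₁ , p = close x≈y (½ ℚ.* ε) (half-pos 0<ε)
            N₂ , q = close y≈z (½ ℚ.* ε) (half-pos 0<ε)
        in N₁ ℕ.⊔ N₂ , λ n n≥ →
          dist-trans (seq x n) (seq y n) (seq z n)
            (p n (proj₁ (⊔-split n≥))) (q n (proj₂ (⊔-split n≥)))
    }

  +-cong : ∀ {x y u v} → x ≈ y → u ≈ v → x + u ≈ y + v
  +-cong {x} {y} {u} {v} x≈y u≈v = mk≈ λ ε 0<ε →
    let N₁ , p = close x≈y (½ ℚ.* ε) (half-pos 0<ε)
        N₂ , q = close u≈v (½ ℚ.* ε) (half-pos 0<ε)
    in N₁ ℕ.⊔ N₂ , λ n n≥ →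
      dist-+ (seq x n) (seq u n) (seq y n) (seq v n)
        (p n (proj₁ (⊔-split n≥))) (q n (proj₂ (⊔-split n≥)))

  -‿cong : ∀ {x y} → x ≈ y → - x ≈ - y
  -‿cong {x} {y} x≈y = mk≈ λ ε 0<ε →
    let N , p = close x≈y ε 0<ε
    in N , λ n n≥ → dist-neg (seq x n) (seq y n) (p n n≥)

  *-cong : ∀ {x y u v} → x ≈ y → u ≈ v → x * u ≈ y * v
  *-cong {x} {y} {u} {v} x≈y u≈v = mk≈ λ ε 0<ε →
    let A , 0<A , M₁ , x<A = bounded x
        D , 0<D , M₂ , v<D = bounded v
        δ₁ , 0<δ₁ , eq₁    = quotient 0<A (half-pos 0<ε)
        δ₂ , 0<δ₂ , eq₂    = quotient 0<D (half-pos 0<ε)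
        N₁ , p             = close x≈y δ₂ 0<δ₂
        N₂ , q             = close u≈v δ₁ 0<δ₁
    in (M₁ ℕ.⊔ M₂) ℕ.⊔ (N₁ ℕ.⊔ N₂) , λ n n≥ →
      let nM , nN = ⊔-split {M₁ ℕ.⊔ M₂} n≥
          m₁ , m₂ = ⊔-split {M₁} nM
          n₁ , n₂ = ⊔-split nN
      in dist-* (seq x n) (seq u n) (seq y n) (seq v n) 0<A 0<D
           (x<A n m₁) (v<D n m₂) eq₁ eq₂ (p n n₁) (q n n₂)

ℝ-isCommutativeRing : IsCommutativeRing _≈_ _+_ _*_ -_ (fromℚ 0ℚ) (fromℚ 1ℚ)
ℝ-isCommutativeRing = record
  { isRing = record
    { +-isAbelianGroup = record
      { isGroup = record
        { isMonoid = record
          { isSemigroup = record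
            { isMagma = record { isEquivalence = ≈-isEquivalence ; ∙-cong = +-cong }
            ; assoc   = λ x y z → pointwise λ n → ℚ.+-assoc (seq x n) (seq y n) (seq z n)
            }
          ; identity = (λ x → pointwise λ n → ℚ.+-identityˡ (seq x n))
                     , (λ x → pointwise λ n → ℚ.+-identityʳ (seq x n))
          }
        ; inverse = (λ x → pointwise λ n → ℚ.+-inverseˡ (seq x n))
                  , (λ x → pointwise λ n → ℚ.+-inverseʳ (seq x n))
        ; ⁻¹-cong = -‿cong
        }
      ; comm = λ x y → pointwise λ n → ℚ.+-comm (seq x n) (seq y n)
      }
    ; *-cong     = *-cong
    ; *-assoc    = λ x y z → pointwise λ n → ℚ.*-assoc (seq x n) (seq y n) (seq z n)
    ; *-identity = (λ x → pointwise λ n → ℚ.*-identityˡ (seq x n))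
                 , (λ x → pointwise λ n → ℚ.*-identityʳ (seq x n))
    ; distrib    =
        (λ x y z → pointwise λ n → ℚ.*-distribˡ-+ (seq x n) (seq y n) (seq z n))
      , (λ x y z → pointwise λ n → ℚ.*-distribʳ-+ (seq x n) (seq y n) (seq z n))
    }
  ; *-comm = λ x y → pointwise λ n → ℚ.*-comm (seq x n) (seq y n)
  }

ℝ-commutativeRing : CommutativeRing 0ℓ 0ℓ
ℝ-commutativeRing = record { isCommutativeRing = ℝ-isCommutativeRing }

-- ⌊√ m ⌋ is the largest r with r² ≤ m.

⌊√_⌋ : ℕ → ℕ
⌊√ zero  ⌋ = zero
⌊√ suc m ⌋ with suc ⌊√ m ⌋ ℕ.* suc ⌊√ m ⌋ ℕ.≤? suc m
... | yes _ = suc ⌊√ m ⌋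
... | no  _ = ⌊√ m ⌋

⌊√⌋-lower : ∀ m → ⌊√ m ⌋ ℕ.* ⌊√ m ⌋ ℕ.≤ m
⌊√⌋-lower zero = ℕ.z≤n
⌊√⌋-lower (suc m) with suc ⌊√ m ⌋ ℕ.* suc ⌊√ m ⌋ ℕ.≤? suc m
... | yes le = le
... | no  _  = ℕ.m≤n⇒m≤1+n (⌊√⌋-lower m)

⌊√⌋-upper : ∀ m → m ℕ.< suc ⌊√ m ⌋ ℕ.* suc ⌊√ m ⌋
⌊√⌋-upper zero = ℕ.z<s
⌊√⌋-upper (suc m) with suc ⌊√ m ⌋ ℕ.* suc ⌊√ m ⌋ ℕ.≤? suc m
... | yes _  = ℕ.≤-<-trans (⌊√⌋-upper m) (ℕ.*-mono-< (ℕ.n<1+n (suc ⌊√ m ⌋)) (ℕ.n<1+n (suc ⌊√ m ⌋)))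
... | no ¬le = ℕ.≰⇒> ¬le

private
  r : ℕ → ℕ
  r n = ⌊√ 2 ℕ.* (suc n ℕ.* suc n) ⌋

-- The largest multiple of 1/(n+1) whose square is at most 2.

√2-seq : ℕ → ℚ
√2-seq n = + ⌊√ 2 ℕ.* (suc n ℕ.* suc n) ⌋ ℚ./ suc n

private
  sq-cancel-< : ∀ {a b} → a ℕ.* a ℕ.< b ℕ.* b → a ℕ.< b
  sq-cancel-< lt = ℕ.≰⇒> λ b≤a → ℕ.<⇒≱ lt (ℕ.*-mono-≤ b≤a b≤a)

  r-cross : ∀ m n → r n ℕ.* suc m ℕ.< suc (r m) ℕ.* suc n
  r-cross m n = sq-cancel-< (begin-strict
    (r n ℕ.* suc m) ℕ.* (r n ℕ.* suc m)
      ≡⟨ swap (r n) (suc m) ⟩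
    (r n ℕ.* r n) ℕ.* (suc m ℕ.* suc m)
      ≤⟨ ℕ.*-monoˡ-≤ (suc m ℕ.* suc m) (⌊√⌋-lower (2 ℕ.* (suc n ℕ.* suc n))) ⟩
    (2 ℕ.* (suc n ℕ.* suc n)) ℕ.* (suc m ℕ.* suc m)
      ≡⟨ swap′ (suc n ℕ.* suc n) (suc m ℕ.* suc m) ⟩
    (2 ℕ.* (suc m ℕ.* suc m)) ℕ.* (suc n ℕ.* suc n)
      <⟨ ℕ.*-monoˡ-< (suc n ℕ.* suc n) (⌊√⌋-upper (2 ℕ.* (suc m ℕ.* suc m))) ⟩
    (suc (r m) ℕ.* suc (r m)) ℕ.* (suc n ℕ.* suc n)
      ≡⟨ swap (suc (r m)) (suc n) ⟨
    (suc (r m) ℕ.* suc n) ℕ.* (suc (r m) ℕ.* suc n) ∎)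
    where
    open ℕ.≤-Reasoning
    open ℕ-Solver.+-*-Solver
    swap : ∀ a b → (a ℕ.* b) ℕ.* (a ℕ.* b) ≡ (a ℕ.* a) ℕ.* (b ℕ.* b)
    swap = solve 2 (λ a b → (a :* b) :* (a :* b) := (a :* a) :* (b :* b)) refl
    swap′ : ∀ a b → (2 ℕ.* a) ℕ.* b ≡ (2 ℕ.* b) ℕ.* a
    swap′ = solve 2 (λ a b → (con 2 :* a) :* b := (con 2 :* b) :* a) refl

  u : ℕ → ℚ
  u n = + 1 ℚ./ suc n

  toℚᵘ-/ : ∀ i n → ℚ.toℚᵘ (i ℚ./ suc n) ℚᵘ.≃ mkℚᵘ i n
  toℚᵘ-/ i n = ℚ.toℚᵘ-fromℚᵘ (mkℚᵘ i n)

  /-mono-< : ∀ i m j n → i ℤ.* + suc n ℤ.< j ℤ.* + suc m → i ℚ./ suc m ℚ.< j ℚ./ suc n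
  /-mono-< i m j n lt = ℚ.toℚᵘ-cancel-<
    (ℚᵘ.<-respˡ-≃ (ℚᵘ.≃-sym (toℚᵘ-/ i m))
      (ℚᵘ.<-respʳ-≃ (ℚᵘ.≃-sym (toℚᵘ-/ j n)) (*<* lt)))

  /-suc : ∀ k n → + k ℚ./ suc n ℚ.+ u n ≡ + suc k ℚ./ suc n
  /-suc k n = ℚ.toℚᵘ-injective (begin
    ℚ.toℚᵘ (+ k ℚ./ suc n ℚ.+ u n)              ≈⟨ ℚ.toℚᵘ-homo-+ (+ k ℚ./ suc n) (u n) ⟩
    ℚ.toℚᵘ (+ k ℚ./ suc n) ℚᵘ.+ ℚ.toℚᵘ (u n)    ≈⟨ ℚᵘ.+-cong (toℚᵘ-/ (+ k) n) (toℚᵘ-/ (+ 1) n) ⟩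
    mkℚᵘ (+ k) n ℚᵘ.+ mkℚᵘ (+ 1) n              ≈⟨ *≡* (lemma (+ k) (+ suc n)) ⟩
    mkℚᵘ (+ suc k) n                            ≈⟨ toℚᵘ-/ (+ suc k) n ⟨
    ℚ.toℚᵘ (+ suc k ℚ./ suc n)                  ∎)
    where
    open ℚᵘ.≃-Reasoning
    open ℤ-Solver.+-*-Solver
    lemma : ∀ a c → (a ℤ.* c ℤ.+ + 1 ℤ.* c) ℤ.* c ≡ (+ 1 ℤ.+ a) ℤ.* (c ℤ.* c)
    lemma = solve 2 (λ a c → (a :* c :+ con (+ 1) :* c) :* c := (con (+ 1) :+ a) :* (c :* c)) refl

  √2-cross : ∀ m n → √2-seq n ℚ.< √2-seq m ℚ.+ u m
  √2-cross m n = subst (√2-seq n ℚ.<_) (sym (/-suc (r m) m))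
    (/-mono-< (+ r n) n (+ suc (r m)) m
      (ℤ.<-≤-trans (ℤ.≤-<-trans (ℤ.≤-reflexive (sym (ℤ.pos-* (r n) (suc m))))
                                (ℤ.+<+ (r-cross m n)))
                   (ℤ.≤-reflexive (ℤ.pos-* (suc (r m)) (suc n)))))

  archimedean : ∀ ε → 0ℚ ℚ.< ε → ∃[ N ] ∀ n → N ℕ.≤ n → u n ℚ.< ε
  archimedean ε@(mkℚ +[1+ k ] d _) _ = suc d , λ n N≤n → ℚ.toℚᵘ-cancel-<
    (ℚᵘ.<-respˡ-≃ (ℚᵘ.≃-sym (toℚᵘ-/ (+ 1) n)) (*<* (ℤ.+<+ (begin-strict
      1 ℕ.* suc d          ≡⟨ ℕ.*-identityˡ (suc d) ⟩
      suc d                <⟨ ℕ.s≤s N≤n ⟩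
      suc n                ≤⟨ ℕ.m≤n*m (suc n) (suc k) ⟩
      suc k ℕ.* suc n      ∎))))
    where open ℕ.≤-Reasoning
  archimedean (mkℚ (+ 0) _ _)       (ℚ.*<* (ℤ.+<+ ()))
  archimedean (mkℚ ℤ.-[1+ _ ] _ _) (ℚ.*<* ())

  within : ∀ p q {ε} → p ℚ.< q ℚ.+ ε → q ℚ.< p ℚ.+ ε → ∣ p ℚ.- q ∣ ℚ.< ε
  within p q {ε} p< q< with ℚ.∣p∣≡p∨∣p∣≡-p (p ℚ.- q)
  ... | inj₁ eq = subst (ℚ._< ε) (sym eq)
    (subst (p ℚ.- q ℚ.<_) (cancel q ε) (ℚ.+-monoˡ-< (ℚ.- q) p<))
    where
    open ℚ-Solver.+-*-Solver
    cancel : ∀ q e → (q ℚ.+ e) ℚ.- q ≡ e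
    cancel = solve 2 (λ q e → (q :+ e) :- q := e) refl
  ... | inj₂ eq = subst (ℚ._< ε) (trans (flip p q) (sym eq))
    (subst (q ℚ.- p ℚ.<_) (cancel p ε) (ℚ.+-monoˡ-< (ℚ.- p) q<))
    where
    open ℚ-Solver.+-*-Solver
    cancel : ∀ q e → (q ℚ.+ e) ℚ.- q ≡ e
    cancel = solve 2 (λ q e → (q :+ e) :- q := e) refl
    flip : ∀ p q → q ℚ.- p ≡ ℚ.- (p ℚ.- q)
    flip = solve 2 (λ p q → q :- p := :- (p :- q)) refl

√2-cauchy : IsCauchy √2-seq
√2-cauchy ε 0<ε =
  let N , u<ε = archimedean ε 0<ε
  in N , λ m n m≥ n≥ → within (√2-seq m) (√2-seq n)
    (ℚ.<-trans (√2-cross n m) (ℚ.+-monoʳ-< (√2-seq n) (u<ε n n≥)))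
    (ℚ.<-trans (√2-cross m n) (ℚ.+-monoʳ-< (√2-seq m) (u<ε m m≥)))

√2 : ℝ
√2 = mkℝ √2-seq √2-cauchy

private
  2ℚ : ℚ
  2ℚ = + 2 ℚ./ 1

  toℚᵘ-sq : ∀ k n → ℚ.toℚᵘ ((+ k ℚ./ suc n) ℚ.* (+ k ℚ./ suc n)) ℚᵘ.≃
                    mkℚᵘ (+ k) n ℚᵘ.* mkℚᵘ (+ k) n
  toℚᵘ-sq k n = ℚᵘ.≃-trans (ℚ.toℚᵘ-homo-* (+ k ℚ./ suc n) (+ k ℚ./ suc n))
                           (ℚᵘ.*-cong (toℚᵘ-/ (+ k) n) (toℚᵘ-/ (+ k) n))

  √2²≤2 : ∀ n → √2-seq n ℚ.* √2-seq n ℚ.≤ 2ℚ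
  √2²≤2 n = ℚ.toℚᵘ-cancel-≤ (ℚᵘ.≤-respˡ-≃ (ℚᵘ.≃-sym (toℚᵘ-sq (r n) n)) (*≤* (begin
    (+ r n ℤ.* + r n) ℤ.* + 1           ≡⟨ ℤ.*-identityʳ _ ⟩
    + r n ℤ.* + r n                     ≡⟨ ℤ.pos-* (r n) (r n) ⟨
    + (r n ℕ.* r n)                     ≤⟨ ℤ.+≤+ (⌊√⌋-lower (2 ℕ.* (suc n ℕ.* suc n))) ⟩
    + (2 ℕ.* (suc n ℕ.* suc n))         ∎)))
    where open ℤ.≤-Reasoning

  2<[√2+u]² : ∀ n → 2ℚ ℚ.< (√2-seq n ℚ.+ u n) ℚ.* (√2-seq n ℚ.+ u n)
  2<[√2+u]² n = subst (λ z → 2ℚ ℚ.< z ℚ.* z) (sym (/-suc (r n) n))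
    (ℚ.toℚᵘ-cancel-< (ℚᵘ.<-respʳ-≃ (ℚᵘ.≃-sym (toℚᵘ-sq (suc (r n)) n)) (*<* (begin-strict
      + (2 ℕ.* (suc n ℕ.* suc n))           <⟨ ℤ.+<+ (⌊√⌋-upper (2 ℕ.* (suc n ℕ.* suc n))) ⟩
      + (suc (r n) ℕ.* suc (r n))           ≡⟨ ℤ.*-identityʳ _ ⟨
      + (suc (r n) ℕ.* suc (r n)) ℤ.* + 1   ∎))))
    where open ℤ.≤-Reasoning

√2*√2≈2 : √2 * √2 ≈ fromℤ (+ 2)
√2*√2≈2 = mk≈ λ ε 0<ε →
  let A , 0<A , M , √2<A = bounded √2
      0<A+A+1            = ℚ.+-mono-< (ℚ.+-mono-< 0<A 0<A) (ℚ.positive⁻¹ 1ℚ)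
      δ , 0<δ , eq       = quotient 0<A+A+1 0<ε
      N , u<δ            = archimedean δ 0<δ
  in M ℕ.⊔ N , λ n n≥ →
    let M≤n , N≤n = ⊔-split {M} n≥
        x = √2-seq n
        uₙ = u n
        instance
          u⁺ : ℚ.Positive uₙ
          u⁺ = ℚ.normalize-pos 1 (suc n)
          u⁰ : ℚ.NonNegative uₙ
          u⁰ = ℚ.pos⇒nonNeg uₙ
        x≤A = ℚ.<⇒≤ (ℚ.≤-<-trans (p≤∣p∣ x) (√2<A n M≤n))
        u≤1 = u≤1ℚ n
    in within (x ℚ.* x) 2ℚ
      (ℚ.≤-<-trans (√2²≤2 n) (subst (ℚ._< 2ℚ ℚ.+ ε) (ℚ.+-identityʳ 2ℚ) (ℚ.+-monoʳ-< 2ℚ 0<ε)))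
      (begin-strict
        2ℚ                                                          <⟨ 2<[√2+u]² n ⟩
        (x ℚ.+ uₙ) ℚ.* (x ℚ.+ uₙ)                                   ≡⟨ expand x uₙ ⟩
        x ℚ.* x ℚ.+ (x ℚ.+ x ℚ.+ uₙ) ℚ.* uₙ                         ≤⟨ ℚ.+-monoʳ-≤ (x ℚ.* x)
                                                                        (ℚ.*-monoʳ-≤-nonNeg uₙ (ℚ.+-mono-≤ (ℚ.+-mono-≤ x≤A x≤A) u≤1)) ⟩
        x ℚ.* x ℚ.+ (A ℚ.+ A ℚ.+ 1ℚ) ℚ.* uₙ                         <⟨ ℚ.+-monoʳ-< (x ℚ.* x)
                                                                        (ℚ.*-monoʳ-<-pos (A ℚ.+ A ℚ.+ 1ℚ) {{ℚ.positive 0<A+A+1}} (u<δ n N≤n)) ⟩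
        x ℚ.* x ℚ.+ (A ℚ.+ A ℚ.+ 1ℚ) ℚ.* δ                          ≡⟨ cong (x ℚ.* x ℚ.+_) eq ⟩
        x ℚ.* x ℚ.+ ε                                               ∎)
  where
  open ℚ.≤-Reasoning
  open ℚ-Solver.+-*-Solver
  expand : ∀ x u → (x ℚ.+ u) ℚ.* (x ℚ.+ u) ≡ x ℚ.* x ℚ.+ (x ℚ.+ x ℚ.+ u) ℚ.* u
  expand = solve 2 (λ x u → (x :+ u) :* (x :+ u) := x :* x :+ (x :+ x :+ u) :* u) refl
  p≤∣p∣ : ∀ p → p ℚ.≤ ∣ p ∣
  p≤∣p∣ p with ℚ.≤-total 0ℚ p
  ... | inj₁ 0≤p = ℚ.≤-reflexive (sym (ℚ.0≤p⇒∣p∣≡p 0≤p))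
  ... | inj₂ p≤0 = ℚ.≤-trans p≤0 (ℚ.0≤∣p∣ p)
  u≤1ℚ : ∀ n → u n ℚ.≤ 1ℚ
  u≤1ℚ n = ℚ.toℚᵘ-cancel-≤ (ℚᵘ.≤-respˡ-≃ (ℚᵘ.≃-sym (toℚᵘ-/ (+ 1) n))
             (*≤* (ℤ.+≤+ (ℕ.s≤s ℕ.z≤n))))

module Quaternions {c ℓ} (R : CommutativeRing c ℓ) where

  open CommutativeRing R using (Carrier; 0#; 1#)
    renaming (_≈_ to _≈ᴿ_; _+_ to _+ᴿ_; _*_ to _*ᴿ_; _-_ to _-ᴿ_; -_ to -ᴿ_)

  infix 4 _≈ᴴ_

  -- ⟨ q₁ , q₂ , q₃ , q₄ ⟩ stands for q₁ + q₂ 𝐢 + q₃ 𝐣 + q₄ 𝐤.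
  record ℍ : Set c where
    constructor ⟨_,_,_,_⟩
    field
      q₁ q₂ q₃ q₄ : Carrier

  record _≈ᴴ_ (p q : ℍ) : Set ℓ where
    constructor mk≈ᴴ
    private
      module p = ℍ p
      module q = ℍ q
    field
      ≈₁ : p.q₁ ≈ᴿ q.q₁
      ≈₂ : p.q₂ ≈ᴿ q.q₂
      ≈₃ : p.q₃ ≈ᴿ q.q₃
      ≈₄ : p.q₄ ≈ᴿ q.q₄

  infixl 6 _+ᴴ_
  infixl 7 _*ᴴ_
  infixr 8 _•_

  _+ᴴ_ : ℍ → ℍ → ℍ
  ⟨ a₁ , a₂ , a₃ , a₄ ⟩ +ᴴ ⟨ b₁ , b₂ , b₃ , b₄ ⟩ =
    ⟨ a₁ +ᴿ b₁ , a₂ +ᴿ b₂ , a₃ +ᴿ b₃ , a₄ +ᴿ b₄ ⟩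

  _*ᴴ_ : ℍ → ℍ → ℍ
  ⟨ a₁ , a₂ , a₃ , a₄ ⟩ *ᴴ ⟨ b₁ , b₂ , b₃ , b₄ ⟩ =
    ⟨ a₁ *ᴿ b₁ -ᴿ a₂ *ᴿ b₂ -ᴿ a₃ *ᴿ b₃ -ᴿ a₄ *ᴿ b₄
    , a₁ *ᴿ b₂ +ᴿ a₂ *ᴿ b₁ +ᴿ a₃ *ᴿ b₄ -ᴿ a₄ *ᴿ b₃
    , a₁ *ᴿ b₃ -ᴿ a₂ *ᴿ b₄ +ᴿ a₃ *ᴿ b₁ +ᴿ a₄ *ᴿ b₂
    , a₁ *ᴿ b₄ +ᴿ a₂ *ᴿ b₃ -ᴿ a₃ *ᴿ b₂ +ᴿ a₄ *ᴿ b₁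
    ⟩

  _•_ : Carrier → ℍ → ℍ
  a • ⟨ b₁ , b₂ , b₃ , b₄ ⟩ = ⟨ a *ᴿ b₁ , a *ᴿ b₂ , a *ᴿ b₃ , a *ᴿ b₄ ⟩

  scalar : Carrier → ℍ
  scalar a = ⟨ a , 0# , 0# , 0# ⟩

  1ᴴ 𝐢 𝐣 𝐤 : ℍ
  1ᴴ = scalar 1#
  𝐢  = ⟨ 0# , 1# , 0# , 0# ⟩
  𝐣  = ⟨ 0# , 0# , 1# , 0# ⟩
  𝐤  = ⟨ 0# , 0# , 0# , 1# ⟩

  conj : ℍ → ℍ
  conj ⟨ a₁ , a₂ , a₃ , a₄ ⟩ = ⟨ a₁ , -ᴿ a₂ , -ᴿ a₃ , -ᴿ a₄ ⟩

  N : ℍ → ℍ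
  N q = q *ᴴ conj q

open Quaternions ℝ-commutativeRing public

-- N q is a quaternion, so an integer is compared with it as a scalar.

IsEvenInteger : ℍ → Set
IsEvenInteger q = ∃[ z ] (+ 2 ℤ.∣ z) × q ≈ᴴ scalar (fromℤ z)

v₁ v₂ v₃ v₄ : ℍ
v₁ = 1ᴴ
v₂ = 𝐢
v₃ = fromℚ ½ • (1ᴴ +ᴴ 𝐢 +ᴴ √2 • 𝐣)
v₄ = fromℚ ½ • (1ᴴ +ᴴ 𝐢 +ᴴ √2 • 𝐤)

infix 4 _∈H₁₂₂

_∈H₁₂₂ : ℍ → Set
g ∈H₁₂₂ = ∃[ a ] ∃[ b ] ∃[ c ] ∃[ d ]
  g ≈ᴴ fromℤ a • v₁ +ᴴ fromℤ b • v₂ +ᴴ fromℤ c • v₃ +ᴴ fromℤ d • v₄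

{-# OPTIONS --safe #-}
-- Let g = a + b 𝐢 + c v₃ + d v₄ and put u = d − c, w = a + b − c.  Since √2 √2 = 2,
-- N g = a² + b² + (a + b)(c + d) + c² + d² + c d, which is u² + u w + w² modulo 2; this is even
-- only if u and w are, say u = 2 m and w = 2 n.  Then (1 − 𝐢) g / 2 and g (1 − 𝐢) / 2
-- have the integer coordinates (c + n, n − a − m, c + m, m) and
-- (c + n + m, n − a, −m, c + m), and they are the cofactors of 1 + 𝐢.

module Submission where

open import Defs
open import Algebra.Bundles using (CommutativeRing)
import Algebra.Construct.Pointwise as Pointwise
open import Algebra.Morphism.Structures using (module RingMorphisms)
import Algebra.Morphism.RingMonomorphism as RingMonomorphism
open import Data.Fin.Patterns using (0F; 1F; 2F; 3F; 4F)
open import Data.Integer.Base as ℤ using (ℤ; +_)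
open import Data.Integer.Divisibility.Signed as Signed using (divides)
open import Data.Integer.DivMod using (_/ℕ_; _%ℕ_; n%ℕd<d; a≡a%ℕn+[a/ℕn]*n)
import Data.Integer.Properties as ℤ
open import Data.Integer.Solver as ℤ-Solver using ()
open import Data.Nat.Base as ℕ using (ℕ; s≤s)
open import Data.Nat.Divisibility using (_∣?_)
import Data.Nat.Properties as ℕ
open import Data.Product.Base using (∃-syntax; _×_; _,_)
open import Data.Rational.Base as ℚ using (ℚ; 0ℚ; 1ℚ; ½)
import Data.Rational.Properties as ℚ
open import Data.Rational.Solver as ℚ-Solver using ()
open import Data.Rational.Unnormalised.Base as ℚᵘ using (mkℚᵘ; *≡*)
import Data.Rational.Unnormalised.Properties as ℚᵘ
open import Data.Sum.Base using (_⊎_; inj₁; inj₂)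
open import Data.Vec.Base using (Vec; []; _∷_)
open import Relation.Binary.PropositionalEquality
  using (_≡_; refl; sym; trans; cong; subst)
open import Relation.Nullary using (¬_; contradiction)
open import Relation.Nullary.Decidable using (yes; no; from-no)

open CommutativeRing ℝ-commutativeRing using (+-cong; *-cong)
  renaming (refl to ≈-refl; trans to ≈-trans)
open ℍ

-- Parity and binary quadratic forms modulo 2.

parity : ∀ i → ∃[ k ] (i ≡ k ℤ.+ k ⊎ i ≡ + 1 ℤ.+ (k ℤ.+ k))
parity i with i %ℕ 2 | n%ℕd<d i 2 | a≡a%ℕn+[a/ℕn]*n i 2
... | 0 | _ | eq = i /ℕ 2 , inj₁ (trans eq (double (i /ℕ 2)))
  where
  open ℤ-Solver.+-*-Solver
  double : ∀ k → + 0 ℤ.+ k ℤ.* + 2 ≡ k ℤ.+ k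
  double = solve 1 (λ k → con (+ 0) :+ k :* con (+ 2) := k :+ k) refl
... | 1 | _ | eq = i /ℕ 2 , inj₂ (trans eq (double (i /ℕ 2)))
  where
  open ℤ-Solver.+-*-Solver
  double : ∀ k → + 1 ℤ.+ k ℤ.* + 2 ≡ + 1 ℤ.+ (k ℤ.+ k)
  double = solve 1 (λ k → con (+ 1) :+ k :* con (+ 2) := con (+ 1) :+ (k :+ k)) refl
... | ℕ.suc (ℕ.suc _) | s≤s (s≤s ()) | _

2∣k+k : ∀ k → + 2 Signed.∣ k ℤ.+ k
2∣k+k k = divides k (lemma k)
  where
  open ℤ-Solver.+-*-Solver
  lemma : ∀ k → k ℤ.+ k ≡ k ℤ.* + 2
  lemma = solve 1 (λ k → k :+ k := k :* con (+ 2)) refl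

-- Removing the even summand leaves `2 ∣ 1`, which is refuted by decision.
odd⇒2∤ : ∀ {i} k → i ≡ + 1 ℤ.+ (k ℤ.+ k) → ¬ (+ 2 Signed.∣ i)
odd⇒2∤ k refl 2∣i =
  from-no (2 ∣? 1) (Signed.∣⇒∣ᵤ {+ 2} {+ 1} (Signed.∣m+n∣n⇒∣m {m = + 1} 2∣i (2∣k+k k)))

-- The norm form of the Eisenstein integers.
eisenstein : ℤ → ℤ → ℤ
eisenstein u w = u ℤ.* u ℤ.+ u ℤ.* w ℤ.+ w ℤ.* w

-- The form has only the trivial zero modulo 2: in each other parity case its value is `1 + (k + k)`
-- for an explicit `k`.
2∣eisenstein⇒even : ∀ u w → + 2 Signed.∣ eisenstein u w →
                    (∃[ m ] u ≡ m ℤ.+ m) × (∃[ n ] w ≡ n ℤ.+ n)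
2∣eisenstein⇒even u w 2∣e with parity u | parity w
... | m , inj₁ u≡ | n , inj₁ w≡ = (m , u≡) , (n , w≡)
... | m , inj₁ refl | n , inj₂ refl = contradiction 2∣e
  (odd⇒2∤ (m ℤ.* (m ℤ.+ m) ℤ.+ m ℤ.* (+ 1 ℤ.+ (n ℤ.+ n)) ℤ.+ (n ℤ.+ n) ℤ.* (+ 1 ℤ.+ n))
    (solve 2 (λ m n → let u = m :+ m; w = con (+ 1) :+ (n :+ n)
                          k = m :* (m :+ m) :+ m :* w :+ (n :+ n) :* (con (+ 1) :+ n)
                      in u :* u :+ u :* w :+ w :* w := con (+ 1) :+ (k :+ k)) refl m n))
  where open ℤ-Solver.+-*-Solver
... | m , inj₂ refl | n , inj₁ refl = contradiction 2∣e
  (odd⇒2∤ ((m ℤ.+ m) ℤ.* (+ 1 ℤ.+ m) ℤ.+ n ℤ.* (+ 1 ℤ.+ (m ℤ.+ m)) ℤ.+ n ℤ.* (n ℤ.+ n))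
    (solve 2 (λ m n → let u = con (+ 1) :+ (m :+ m); w = n :+ n
                          k = (m :+ m) :* (con (+ 1) :+ m) :+ n :* u :+ n :* (n :+ n)
                      in u :* u :+ u :* w :+ w :* w := con (+ 1) :+ (k :+ k)) refl m n))
  where open ℤ-Solver.+-*-Solver
... | m , inj₂ refl | n , inj₂ refl = contradiction 2∣e
  -- Each of `u u`, `u w`, `w w` is odd here; the three ones give 1 + 2, whence the summand `+ 1` in
  -- `k`.
  (odd⇒2∤ (let u = + 1 ℤ.+ (m ℤ.+ m) in
           (m ℤ.+ m) ℤ.* (+ 1 ℤ.+ m) ℤ.+ (m ℤ.+ n ℤ.+ (m ℤ.* n ℤ.+ m ℤ.* n)) ℤ.+ + 1
             ℤ.+ (n ℤ.+ n) ℤ.* (+ 1 ℤ.+ n))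
    (solve 2 (λ m n → let u = con (+ 1) :+ (m :+ m); w = con (+ 1) :+ (n :+ n)
                          k = (m :+ m) :* (con (+ 1) :+ m) :+ (m :+ n :+ (m :* n :+ m :* n))
                                :+ con (+ 1) :+ (n :+ n) :* (con (+ 1) :+ n)
                      in u :* u :+ u :* w :+ w :* w := con (+ 1) :+ (k :+ k)) refl m n))
  where open ℤ-Solver.+-*-Solver

normForm : ℤ → ℤ → ℤ → ℤ → ℤ
normForm a b c d = a ℤ.* a ℤ.+ b ℤ.* b ℤ.+ (a ℤ.+ b) ℤ.* (c ℤ.+ d)
                   ℤ.+ (c ℤ.* c ℤ.+ d ℤ.* d ℤ.+ c ℤ.* d)

-- The congruences are solved for `b` and `d`, so that matching on `refl` later leaves `a`, `c`,
-- `m`, `n` as free parameters.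
2∣normForm⇒congruent : ∀ a b c d → + 2 Signed.∣ normForm a b c d →
  ∃[ m ] ∃[ n ] b ≡ c ℤ.+ (n ℤ.+ n) ℤ.- a × d ≡ c ℤ.+ (m ℤ.+ m)
2∣normForm⇒congruent a b c d 2∣F =
  let u = d ℤ.- c
      w = a ℤ.+ b ℤ.- c
      v = a ℤ.+ b ℤ.+ u
      -- Half the difference between the norm form and `eisenstein u w`.
      k = c ℤ.* v ℤ.+ c ℤ.* v ℤ.+ c ℤ.* c ℤ.- a ℤ.* b
      (m , u≡) , (n , w≡) = 2∣eisenstein⇒even u w
        (Signed.∣m+n∣n⇒∣m {m = eisenstein u w}
          (subst (+ 2 Signed.∣_) (reduce a b c d) 2∣F) (2∣k+k k))
  in m , n
     , trans (b≡ a b c) (cong (λ w → c ℤ.+ w ℤ.- a) w≡)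
     , trans (d≡ c d) (cong (λ u → c ℤ.+ u) u≡)
  where
  open ℤ-Solver.+-*-Solver
  reduce : ∀ a b c d →
    let u = d ℤ.- c
        w = a ℤ.+ b ℤ.- c
        v = a ℤ.+ b ℤ.+ u
        k = c ℤ.* v ℤ.+ c ℤ.* v ℤ.+ c ℤ.* c ℤ.- a ℤ.* b
    in normForm a b c d ≡ eisenstein u w ℤ.+ (k ℤ.+ k)
  reduce = solve 4 (λ a b c d →
    let u = d :- c
        w = a :+ b :- c
        v = a :+ b :+ u
        k = c :* v :+ c :* v :+ c :* c :- a :* b
    in a :* a :+ b :* b :+ (a :+ b) :* (c :+ d) :+ (c :* c :+ d :* d :+ c :* d)
       := u :* u :+ u :* w :+ w :* w :+ (k :+ k)) refl
  b≡ : ∀ a b c → b ≡ c ℤ.+ (a ℤ.+ b ℤ.- c) ℤ.- a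
  b≡ = solve 3 (λ a b c → b := c :+ (a :+ b :- c) :- a) refl
  d≡ : ∀ c d → d ≡ c ℤ.+ (d ℤ.- c)
  d≡ = solve 2 (λ c d → d := c :+ (d :- c)) refl

-- The embeddings of ℤ in ℚ and of ℚ in ℝ.

φ : ℤ → ℚ
φ i = i ℚ./ 1

-- `φ i` is normalised and does not compute for a variable `i`, so its arithmetic is done on
-- unnormalised fractions. `mkℚᵘ` stores the denominator minus one: 0 means denominator 1.
toℚᵘ-φ : ∀ i → ℚ.toℚᵘ (φ i) ℚᵘ.≃ mkℚᵘ i 0
toℚᵘ-φ i = ℚ.toℚᵘ-fromℚᵘ (mkℚᵘ i 0)

φ-injective : ∀ {i j} → φ i ≡ φ j → i ≡ j
φ-injective {i} {j} eq
  with *≡* i1≡j1 ← ℚᵘ.≃-trans (ℚᵘ.≃-sym (toℚᵘ-φ i))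
                     (ℚᵘ.≃-trans (ℚᵘ.≃-reflexive (cong ℚ.toℚᵘ eq)) (toℚᵘ-φ j))
  = ℤ.*-cancelʳ-≡ i j (+ 1) i1≡j1

-- Taking the images as equations lets `φ-+`, `φ-*` and `φ-neg` nest along the syntax tree of an
-- integer expression.
φ-+ : ∀ i j {p q} → φ i ≡ p → φ j ≡ q → φ (i ℤ.+ j) ≡ p ℚ.+ q
φ-+ i j refl refl = ℚ.toℚᵘ-injective (begin
  ℚ.toℚᵘ (φ (i ℤ.+ j))               ≈⟨ toℚᵘ-φ (i ℤ.+ j) ⟩
  mkℚᵘ (i ℤ.+ j) 0                   ≈⟨ *≡* (lemma i j) ⟩
  mkℚᵘ i 0 ℚᵘ.+ mkℚᵘ j 0             ≈⟨ ℚᵘ.+-cong (toℚᵘ-φ i) (toℚᵘ-φ j) ⟨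
  ℚ.toℚᵘ (φ i) ℚᵘ.+ ℚ.toℚᵘ (φ j)     ≈⟨ ℚ.toℚᵘ-homo-+ (φ i) (φ j) ⟨
  ℚ.toℚᵘ (φ i ℚ.+ φ j)               ∎)
  where
  open ℚᵘ.≃-Reasoning
  open ℤ-Solver.+-*-Solver
  lemma : ∀ i j → (i ℤ.+ j) ℤ.* + 1 ≡ (i ℤ.* + 1 ℤ.+ j ℤ.* + 1) ℤ.* + 1
  lemma = solve 2 (λ i j → let 1′ = con (+ 1) in
                           (i :+ j) :* 1′ := (i :* 1′ :+ j :* 1′) :* 1′) refl

φ-* : ∀ i j {p q} → φ i ≡ p → φ j ≡ q → φ (i ℤ.* j) ≡ p ℚ.* q
φ-* i j refl refl = ℚ.toℚᵘ-injective (begin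
  ℚ.toℚᵘ (φ (i ℤ.* j))               ≈⟨ toℚᵘ-φ (i ℤ.* j) ⟩
  mkℚᵘ i 0 ℚᵘ.* mkℚᵘ j 0             ≈⟨ ℚᵘ.*-cong (toℚᵘ-φ i) (toℚᵘ-φ j) ⟨
  ℚ.toℚᵘ (φ i) ℚᵘ.* ℚ.toℚᵘ (φ j)     ≈⟨ ℚ.toℚᵘ-homo-* (φ i) (φ j) ⟨
  ℚ.toℚᵘ (φ i ℚ.* φ j)               ∎)
  where open ℚᵘ.≃-Reasoning

φ-neg : ∀ i {p} → φ i ≡ p → φ (ℤ.- i) ≡ ℚ.- p
φ-neg i refl = ℚ.toℚᵘ-injective (begin
  ℚ.toℚᵘ (φ (ℤ.- i))     ≈⟨ toℚᵘ-φ (ℤ.- i) ⟩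
  ℚᵘ.- mkℚᵘ i 0          ≈⟨ ℚᵘ.-‿cong (toℚᵘ-φ i) ⟨
  ℚᵘ.- ℚ.toℚᵘ (φ i)      ≈⟨ ℚ.toℚᵘ-homo‿- (φ i) ⟨
  ℚ.toℚᵘ (ℚ.- φ i)       ∎)
  where open ℚᵘ.≃-Reasoning

pointwise : ∀ {x y} → (∀ k → seq x k ≡ seq y k) → x ≈ y
pointwise {x} {y} eq = mk≈ λ ε 0<ε → 0 , λ k _ →
  subst (ℚ._< ε) (sym (trans (cong (λ z → ℚ.∣ z ℚ.- seq y k ∣) (eq k))
                             (cong ℚ.∣_∣ (ℚ.+-inverseʳ (seq y k))))) 0<ε

-- If `p` and `q` differed, closeness with ε equal to their distance would make this constant
-- distance smaller than itself.
fromℚ-injective : ∀ {p q} → fromℚ p ≈ fromℚ q → p ≡ q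
fromℚ-injective {p} {q} p≈q with p ℚ.≟ q
... | yes p≡q = p≡q
... | no p≢q =
  let N , dist< = close p≈q ℚ.∣ p ℚ.- q ∣
        (ℚ.≰⇒> λ ≤0 → p≢q (x∙y⁻¹≈ε⇒x≈y p q
          (ℚ.∣p∣≡0⇒p≡0 (p ℚ.- q) (ℚ.≤-antisym ≤0 (ℚ.0≤∣p∣ (p ℚ.- q))))))
  in contradiction (dist< N ℕ.≤-refl) (ℚ.<-irrefl refl)
  where open import Algebra.Properties.Group ℚ.+-0-group using (x∙y⁻¹≈ε⇒x≈y)

-- Coordinates with respect to `v₁`, `v₂`, `v₃`, `v₄`.

module Combination {c ℓ} (R : CommutativeRing c ℓ)
                   (h s : CommutativeRing.Carrier R) where
  private module Q = Quaternions R

  -- Generic in the ring, so that one expression is read both over ℝ and over polynomials; `h`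
  -- stands for ½ and `s` for `√2`.
  combination : (a b c d : CommutativeRing.Carrier R) → Q.ℍ
  combination a b c d = a Q.• Q.1ᴴ Q.+ᴴ b Q.• Q.𝐢
    Q.+ᴴ c Q.• h Q.• (Q.1ᴴ Q.+ᴴ Q.𝐢 Q.+ᴴ s Q.• Q.𝐣)
    Q.+ᴴ d Q.• h Q.• (Q.1ᴴ Q.+ᴴ Q.𝐢 Q.+ᴴ s Q.• Q.𝐤)

combination : ℚ → ℚ → ℚ → ℚ → ℍ
combination a b c d = Combination.combination ℝ-commutativeRing (fromℚ ½) √2
  (fromℚ a) (fromℚ b) (fromℚ c) (fromℚ d)

-- Polynomials form a commutative ring, so quaternions over them are the solver's
-- syntax for the coordinates of a quaternion expression.
module Polynomials where
  open ℚ-Solver.+-*-Solver public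

  private
    valueRing : CommutativeRing _ _
    valueRing = Pointwise.commutativeRing (Vec ℚ 5) ℚ.+-*-commutativeRing
    module V = CommutativeRing valueRing

  polynomialRing : CommutativeRing _ _
  polynomialRing = record
    { isCommutativeRing = RingMonomorphism.isCommutativeRing {R₁ = rawPolynomialRing}
        isRingMonomorphism V.isCommutativeRing }
    where
    rawPolynomialRing = record
      { Carrier = Polynomial 5
      -- Equality of polynomials is equality of all values, so evaluation is injective by definition
      -- and the ring laws pull back along it.
      ; _≈_ = λ p q → ⟦ p ⟧ V.≈ ⟦ q ⟧
      ; _+_ = _:+_ ; _*_ = _:*_ ; -_ = :-_ ; 0# = con 0ℚ ; 1# = con 1ℚ }
    open RingMorphisms rawPolynomialRing V.rawRing
    isRingMonomorphism : IsRingMonomorphism ⟦_⟧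
    isRingMonomorphism = record
      { isRingHomomorphism = record
        { isSemiringHomomorphism = record
          { isNearSemiringHomomorphism = record
            { +-isMonoidHomomorphism = record
              { isMagmaHomomorphism = record
                { isRelHomomorphism = record { cong = λ eq → eq }
                ; homo = λ p q → V.refl {⟦ p :+ q ⟧} }
              ; ε-homo = V.refl {⟦ con 0ℚ ⟧} }
            ; *-homo = λ p q → V.refl {⟦ p :* q ⟧} }
          ; 1#-homo = V.refl {⟦ con 1ℚ ⟧} }
        ; -‿homo = λ p → V.refl {⟦ :- p ⟧} }
      ; injective = λ eq → eq }

  open Quaternions polynomialRing public
    using (ℍ; module ℍ; 1ᴴ; 𝐢; _+ᴴ_; _*ᴴ_; N)
  open Combination polynomialRing (con ½) (var 4F) public

-- The factorisation identities over ℚ.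

module _ (a c m n : ℚ) where
  private
    module P = Polynomials
    open Polynomials using (Polynomial; var; _:+_; _:-_; :-_)

    ρ : ℕ → Vec ℚ 5
    -- The last slot, `var 4F`, holds the `k`-th rational approximation of `√2`.
    ρ k = a ∷ c ∷ m ∷ n ∷ seq √2 k ∷ []

    a′ b′ c′ d′ m′ n′ : Polynomial 5
    a′ = var 0F
    c′ = var 1F
    m′ = var 2F
    n′ = var 3F
    b′ = c′ :+ (n′ :+ n′) :- a′
    d′ = c′ :+ (m′ :+ m′)

    g l r : P.ℍ
    g = P.combination a′ b′ c′ d′
    l = (P.1ᴴ P.+ᴴ P.𝐢) P.*ᴴ P.combination (c′ :+ n′) (n′ :- a′ :- m′) (c′ :+ m′) m′
    r = P.combination (c′ :+ n′ :+ m′) (n′ :- a′) (:- m′) (c′ :+ m′) P.*ᴴ (P.1ᴴ P.+ᴴ P.𝐢)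

  -- Both sides are linear in `√2`, so each coordinate is a polynomial identity that holds with any
  -- rational in its place, hence term by term.
  left-factor : combination a (c ℚ.+ (n ℚ.+ n) ℚ.- a) c (c ℚ.+ (m ℚ.+ m))
    ≈ᴴ (1ᴴ +ᴴ 𝐢) *ᴴ combination (c ℚ.+ n) (n ℚ.- a ℚ.- m) (c ℚ.+ m) m
  left-factor = mk≈ᴴ
    (pointwise λ k → P.prove (ρ k) (P.ℍ.q₁ g) (P.ℍ.q₁ l) refl)
    (pointwise λ k → P.prove (ρ k) (P.ℍ.q₂ g) (P.ℍ.q₂ l) refl)
    (pointwise λ k → P.prove (ρ k) (P.ℍ.q₃ g) (P.ℍ.q₃ l) refl)
    (pointwise λ k → P.prove (ρ k) (P.ℍ.q₄ g) (P.ℍ.q₄ l) refl)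

  right-factor : combination a (c ℚ.+ (n ℚ.+ n) ℚ.- a) c (c ℚ.+ (m ℚ.+ m))
    ≈ᴴ combination (c ℚ.+ n ℚ.+ m) (n ℚ.- a) (ℚ.- m) (c ℚ.+ m) *ᴴ (1ᴴ +ᴴ 𝐢)
  right-factor = mk≈ᴴ
    (pointwise λ k → P.prove (ρ k) (P.ℍ.q₁ g) (P.ℍ.q₁ r) refl)
    (pointwise λ k → P.prove (ρ k) (P.ℍ.q₂ g) (P.ℍ.q₂ r) refl)
    (pointwise λ k → P.prove (ρ k) (P.ℍ.q₃ g) (P.ℍ.q₃ r) refl)
    (pointwise λ k → P.prove (ρ k) (P.ℍ.q₄ g) (P.ℍ.q₄ r) refl)

-- The norm in coordinates.

normFormℚ : ℚ → ℚ → ℚ → ℚ → ℚ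
normFormℚ a b c d = a ℚ.* a ℚ.+ b ℚ.* b ℚ.+ (a ℚ.+ b) ℚ.* (c ℚ.+ d)
                    ℚ.+ (c ℚ.* c ℚ.+ d ℚ.* d ℚ.+ c ℚ.* d)

φ-normForm : ∀ a b c d → φ (normForm a b c d) ≡ normFormℚ (φ a) (φ b) (φ c) (φ d)
φ-normForm a b c d =
  φ-+ (a ℤ.* a ℤ.+ b ℤ.* b ℤ.+ (a ℤ.+ b) ℤ.* (c ℤ.+ d)) (c ℤ.* c ℤ.+ d ℤ.* d ℤ.+ c ℤ.* d)
    (φ-+ (a ℤ.* a ℤ.+ b ℤ.* b) ((a ℤ.+ b) ℤ.* (c ℤ.+ d))
      (φ-+ (a ℤ.* a) (b ℤ.* b) (φ-* a a refl refl) (φ-* b b refl refl))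
      (φ-* (a ℤ.+ b) (c ℤ.+ d) (φ-+ a b refl refl) (φ-+ c d refl refl)))
    (φ-+ (c ℤ.* c ℤ.+ d ℤ.* d) (c ℤ.* d)
      (φ-+ (c ℤ.* c) (d ℤ.* d) (φ-* c c refl refl) (φ-* d d refl refl))
      (φ-* c d refl refl))

-- The real part of the norm is `x + y * (√2 * √2)` term by term. Replacing `√2 * √2` by 2 is valid
-- only up to `≈`; afterwards `x + 2 y` equals the form by an identity over ℚ.
N-combination : ∀ a b c d → q₁ (N (combination a b c d)) ≈ fromℚ (normFormℚ a b c d)
N-combination a b c d = ≈-trans {_} {fromℚ x + fromℚ y * (√2 * √2)}
  (pointwise λ k → P.prove (a ∷ b ∷ c ∷ d ∷ seq √2 k ∷ [])
    (P.ℍ.q₁ (P.N (P.combination a′ b′ c′ d′))) (x′ :+ y′ :* (s′ :* s′)) refl)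
  (≈-trans {_} {fromℚ x + fromℚ y * fromℤ (+ 2)}
    (+-cong {fromℚ x} {fromℚ x} {fromℚ y * (√2 * √2)} {fromℚ y * fromℤ (+ 2)}
      (≈-refl {fromℚ x})
      (*-cong {fromℚ y} {fromℚ y} {√2 * √2} {fromℤ (+ 2)} (≈-refl {fromℚ y}) √2*√2≈2))
    (pointwise λ k → P.prove (a ∷ b ∷ c ∷ d ∷ seq √2 k ∷ [])
      (x′ :+ y′ :* con (φ (+ 2)))
      (a′ :* a′ :+ b′ :* b′ :+ (a′ :+ b′) :* (c′ :+ d′) :+ (c′ :* c′ :+ d′ :* d′ :+ c′ :* d′))
      refl))
  where
  module P = Polynomials
  open Polynomials using (Polynomial; var; con; _:+_; _:*_)
  x = a ℚ.* a ℚ.+ b ℚ.* b ℚ.+ (a ℚ.+ b) ℚ.* (c ℚ.+ d) ℚ.+ ½ ℚ.* ((c ℚ.+ d) ℚ.* (c ℚ.+ d))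
  y = ½ ℚ.* ½ ℚ.* (c ℚ.* c ℚ.+ d ℚ.* d)
  a′ b′ c′ d′ s′ x′ y′ : Polynomial 5
  a′ = var 0F
  b′ = var 1F
  c′ = var 2F
  d′ = var 3F
  s′ = var 4F
  x′ = a′ :* a′ :+ b′ :* b′ :+ (a′ :+ b′) :* (c′ :+ d′) :+ con ½ :* ((c′ :+ d′) :* (c′ :+ d′))
  y′ = con ½ :* con ½ :* (c′ :* c′ :+ d′ :* d′)

-- Stated over an arbitrary ring: over ℝ, conversion checking would unfold the proofs
-- that sums and products are Cauchy.
module QuaternionCongruence {c ℓ} (R : CommutativeRing c ℓ) where
  private
    module R = CommutativeRing R
    module Q = Quaternions R

    minus-cong : ∀ {x x′ y y′} → x R.≈ x′ → y R.≈ y′ → x R.- y R.≈ x′ R.- y′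
    minus-cong x≈ y≈ = R.+-cong x≈ (R.-‿cong y≈)

  ≈ᴴ-trans : ∀ {p q r} → p Q.≈ᴴ q → q Q.≈ᴴ r → p Q.≈ᴴ r
  ≈ᴴ-trans (Q.mk≈ᴴ e₁ e₂ e₃ e₄) (Q.mk≈ᴴ f₁ f₂ f₃ f₄) =
    Q.mk≈ᴴ (R.trans e₁ f₁) (R.trans e₂ f₂) (R.trans e₃ f₃) (R.trans e₄ f₄)

  q₁-N-cong : ∀ {p q} → p Q.≈ᴴ q → Q.ℍ.q₁ (Q.N p) R.≈ Q.ℍ.q₁ (Q.N q)
  q₁-N-cong (Q.mk≈ᴴ e₁ e₂ e₃ e₄) =
    minus-cong (minus-cong (minus-cong (R.*-cong e₁ e₁) (x*-x-cong e₂)) (x*-x-cong e₃))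
               (x*-x-cong e₄)
    where
    x*-x-cong : ∀ {x y} → x R.≈ y → x R.* R.- x R.≈ y R.* R.- y
    x*-x-cong x≈y = R.*-cong x≈y (R.-‿cong x≈y)

  N-scalar-unique : ∀ p q x y → p Q.≈ᴴ q → Q.ℍ.q₁ (Q.N q) R.≈ x → Q.N p Q.≈ᴴ Q.scalar y →
                    x R.≈ y
  N-scalar-unique p q x y p≈q Nq≈x (Q.mk≈ᴴ Np≈y _ _ _) =
    R.trans (R.trans (R.sym Nq≈x) (R.sym (q₁-N-cong p≈q))) Np≈y

open QuaternionCongruence ℝ-commutativeRing

-- Both integers have the real part of `N g` as their image in ℝ, and the embedding is injective; so
-- evenness of `z` passes to the form.
normForm≡N : ∀ g z a b c d → g ≈ᴴ combination (φ a) (φ b) (φ c) (φ d) →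
             N g ≈ᴴ scalar (fromℤ z) → normForm a b c d ≡ z
normForm≡N g z a b c d g≈ Ng≈z = φ-injective (trans (φ-normForm a b c d)
  (fromℚ-injective {q = φ z}
    (N-scalar-unique g (combination (φ a) (φ b) (φ c) (φ d))
      (fromℚ (normFormℚ (φ a) (φ b) (φ c) (φ d))) (fromℤ z)
      g≈ (N-combination (φ a) (φ b) (φ c) (φ d)) Ng≈z)))

-- Integral cofactors and membership in `_∈H₁₂₂`.

module _ (a c m n : ℤ) where
  private
    φ-b : φ (c ℤ.+ (n ℤ.+ n) ℤ.- a) ≡ φ c ℚ.+ (φ n ℚ.+ φ n) ℚ.- φ a
    φ-b = φ-+ (c ℤ.+ (n ℤ.+ n)) (ℤ.- a) (φ-+ c (n ℤ.+ n) refl (φ-+ n n refl refl)) (φ-neg a refl)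

    φ-d : φ (c ℤ.+ (m ℤ.+ m)) ≡ φ c ℚ.+ (φ m ℚ.+ φ m)
    φ-d = φ-+ c (m ℤ.+ m) refl (φ-+ m m refl refl)

  left-factorℤ : combination (φ a) (φ (c ℤ.+ (n ℤ.+ n) ℤ.- a)) (φ c) (φ (c ℤ.+ (m ℤ.+ m)))
    ≈ᴴ (1ᴴ +ᴴ 𝐢) *ᴴ combination (φ (c ℤ.+ n)) (φ (n ℤ.- a ℤ.- m)) (φ (c ℤ.+ m)) (φ m)
  left-factorℤ = transport
    (φ (c ℤ.+ (n ℤ.+ n) ℤ.- a)) (φ (c ℤ.+ (m ℤ.+ m)))
    (φ (c ℤ.+ n)) (φ (n ℤ.- a ℤ.- m)) (φ (c ℤ.+ m))
    φ-b φ-d (φ-+ c n refl refl)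
    (φ-+ (n ℤ.- a) (ℤ.- m) (φ-+ n (ℤ.- a) refl (φ-neg a refl)) (φ-neg m refl))
    (φ-+ c m refl refl)
    where
    -- The images under `φ` become variables, so that their equations can be matched with `refl`.
    transport : ∀ b d x y z →
      b ≡ φ c ℚ.+ (φ n ℚ.+ φ n) ℚ.- φ a → d ≡ φ c ℚ.+ (φ m ℚ.+ φ m) →
      x ≡ φ c ℚ.+ φ n → y ≡ φ n ℚ.- φ a ℚ.- φ m → z ≡ φ c ℚ.+ φ m →
      combination (φ a) b (φ c) d ≈ᴴ (1ᴴ +ᴴ 𝐢) *ᴴ combination x y z (φ m)
    transport _ _ _ _ _ refl refl refl refl refl = left-factor (φ a) (φ c) (φ m) (φ n)

  right-factorℤ : combination (φ a) (φ (c ℤ.+ (n ℤ.+ n) ℤ.- a)) (φ c) (φ (c ℤ.+ (m ℤ.+ m)))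
    ≈ᴴ combination (φ (c ℤ.+ n ℤ.+ m)) (φ (n ℤ.- a)) (φ (ℤ.- m)) (φ (c ℤ.+ m)) *ᴴ (1ᴴ +ᴴ 𝐢)
  right-factorℤ = transport
    (φ (c ℤ.+ (n ℤ.+ n) ℤ.- a)) (φ (c ℤ.+ (m ℤ.+ m)))
    (φ (c ℤ.+ n ℤ.+ m)) (φ (n ℤ.- a)) (φ (ℤ.- m)) (φ (c ℤ.+ m))
    φ-b φ-d (φ-+ (c ℤ.+ n) m (φ-+ c n refl refl) refl)
    (φ-+ n (ℤ.- a) refl (φ-neg a refl)) (φ-neg m refl) (φ-+ c m refl refl)
    where
    transport : ∀ b d x y z w →
      b ≡ φ c ℚ.+ (φ n ℚ.+ φ n) ℚ.- φ a → d ≡ φ c ℚ.+ (φ m ℚ.+ φ m) →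
      x ≡ φ c ℚ.+ φ n ℚ.+ φ m → y ≡ φ n ℚ.- φ a → z ≡ ℚ.- φ m → w ≡ φ c ℚ.+ φ m →
      combination (φ a) b (φ c) d ≈ᴴ combination x y z w *ᴴ (1ᴴ +ᴴ 𝐢)
    transport _ _ _ _ _ _ refl refl refl refl refl refl =
      right-factor (φ a) (φ c) (φ m) (φ n)

combination-∈H₁₂₂ : ∀ a b c d → combination (φ a) (φ b) (φ c) (φ d) ∈H₁₂₂
combination-∈H₁₂₂ a b c d = a , b , c , d , mk≈ᴴ
  (pointwise λ _ → refl) (pointwise λ _ → refl) (pointwise λ _ → refl) (pointwise λ _ → refl)

∈H₁₂₂⇒≈combination : ∀ {g} → g ∈H₁₂₂ →
  ∃[ a ] ∃[ b ] ∃[ c ] ∃[ d ] g ≈ᴴ combination (φ a) (φ b) (φ c) (φ d)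
∈H₁₂₂⇒≈combination (a , b , c , d , g≈) = a , b , c , d , ≈ᴴ-trans g≈ (mk≈ᴴ
  (pointwise λ _ → refl) (pointwise λ _ → refl) (pointwise λ _ → refl) (pointwise λ _ → refl))

combination-factors : ∀ g a b c d → g ≈ᴴ combination (φ a) (φ b) (φ c) (φ d) →
  ∃[ m ] ∃[ n ] b ≡ c ℤ.+ (n ℤ.+ n) ℤ.- a × d ≡ c ℤ.+ (m ℤ.+ m) →
  (∃[ h ] (h ∈H₁₂₂) × (g ≈ᴴ (1ᴴ +ᴴ 𝐢) *ᴴ h)) ×
  (∃[ h′ ] (h′ ∈H₁₂₂) × (g ≈ᴴ h′ *ᴴ (1ᴴ +ᴴ 𝐢)))
combination-factors g a b c d g≈ (m , n , refl , refl) =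
    (_ , combination-∈H₁₂₂ (c ℤ.+ n) (n ℤ.- a ℤ.- m) (c ℤ.+ m) m
       , ≈ᴴ-trans g≈ (left-factorℤ a c m n))
  , (_ , combination-∈H₁₂₂ (c ℤ.+ n ℤ.+ m) (n ℤ.- a) (ℤ.- m) (c ℤ.+ m)
       , ≈ᴴ-trans g≈ (right-factorℤ a c m n))

theorem3 : (g : ℍ) → g ∈H₁₂₂ → IsEvenInteger (N g) →
    (∃[ h ] (h ∈H₁₂₂) × (g ≈ᴴ (1ᴴ +ᴴ 𝐢) *ᴴ h)) ×
    (∃[ h′ ] (h′ ∈H₁₂₂) × (g ≈ᴴ h′ *ᴴ (1ᴴ +ᴴ 𝐢)))
theorem3 g g∈H (z , 2∣z , Ng≈z) =
  let a , b , c , d , g≈ = ∈H₁₂₂⇒≈combination g∈H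
  in combination-factors g a b c d g≈ (2∣normForm⇒congruent a b c d
       -- The hypothesis states divisibility of absolute values; it is converted to an explicit
       -- integer quotient.
       (subst (+ 2 Signed.∣_) (sym (normForm≡N g z a b c d g≈ Ng≈z)) (Signed.∣ᵤ⇒∣ {+ 2} {z} 2∣z)))
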